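{- For every real $\lambda>0$ there is an algorithm for makespan scheduling with predictions on restricted-assignment machines under weighted binary budget uncertainty, restricted to instances in which every job $j$ with $p_j^+-p_j^->0$ satisfies $w_j\le\Gamma$, that has consistency $1+1/\lambda$ and robustness $4+2\lambda$. That is, for every such instance (numbers of machines $m$ and jobs $n$, eligibility sets, intervals $[p_j^-,p_j^+]$, weights $w_j>0$ and budget $\Gamma\ge0$, defining the uncertainty set $\mathcal U$) and every predicted scenario $\hat q\in\mathcal U$, the algorithm returns a schedule $\mathcal S$ with $$C_{\max}(\mathcal S,\hat q)\le\Big(1+\frac1\lambda\Big)\mathrm{OPT}(\hat q)\quad\text{and}\quad \max_{q\in\mathcal U}C_{\max}(\mathcal S,q)\le(4+2\lambda)\,\mathrm{OPT}^{\mathrm{rob}}(\mathcal U).$$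
   Context: There are $m$ machines and $n$ jobs. A scenario is a matrix $q$ with entries $q_{i,j}\in[0,\infty]$. A schedule is a partition $\mathcal S=(S_1,\dots,S_m)$ of $[n]$ (parts may be empty), and $C_{\max}(\mathcal S,q)=\max_{i\in[m]}\sum_{j\in S_i}q_{i,j}$. $\mathrm{OPT}(q)=\min_{\mathcal S}C_{\max}(\mathcal S,q)$ and $\mathrm{OPT}^{\mathrm{rob}}(\mathcal U)=\min_{\mathcal S}\max_{q\in\mathcal U}C_{\max}(\mathcal S,q)$. Restricted assignment: each job $j$ has a size $p_j\ge0$ and an eligibility set $M_j\subseteq[m]$, and $q_{i,j}=p_j$ if $i\in M_j$, $q_{i,j}=\infty$ otherwise. Weighted binary budget uncertainty: for given $0\le p_j^-\le p_j^+$, weights $w_j>0$ and $\Gamma\ge0$, $\mathcal U$ is the set of all scenarios obtained (with fixed eligibility sets) from size vectors $p$ for which there is $T\subseteq[n]$ with $\sum_{j\in T}w_j\le\Gamma$, $p_j=p_j^-$ for $j\notin T$ and $p_j\in[p_j^-,p_j^+]$ for $j\in T$. An algorithm is a map from inputs to schedules; no computational restriction is imposed. -}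

module Defs where

open import Algebra.Bundles using (CommutativeRing)
import Algebra.Construct.NaturalChoice.Max as Max
import Algebra.Definitions.RawMonoid as RawMonoidDefs
open import Data.Bool.Base using (if_then_else_)
open import Data.Fin.Base using (Fin)
open import Data.Fin.Subset using (Subset; _∈_; _∉_)
open import Data.Fin.Subset.Properties using (_∈?_)
open import Data.Nat.Base using (ℕ; NonZero)
open import Data.Product.Base using (_×_; ∃; ∃-syntax)
open import Data.Vec.Functional using (Vector; foldr)
open import Level using (Level; suc; _⊔_)
open import Relation.Binary.Bundles using (TotalOrder)
open import Relation.Binary.Core using (Rel)
open import Relation.Binary.PropositionalEquality.Core using (_≡_)
import Relation.Binary.Construct.Add.Supremum.Equality as AddSupEquality
import Relation.Binary.Construct.Add.Supremum.NonStrict as AddSupNonStrict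
import Relation.Binary.Construct.NonStrictToStrict as ToStrict
open import Relation.Binary.Structures using (IsDecTotalOrder)
open import Relation.Nullary.Construct.Add.Supremum using (_⁺; [_]; ⊤⁺)
open import Relation.Nullary.Decidable.Core using (does)
open import Relation.Nullary.Negation.Core using (¬_)
open import Relation.Unary using (Pred)

-- The classical real numbers, axiomatised as a Dedekind-complete ordered
-- field.  The order is decidable because the intended reals are the classical
-- ones: no instance is definable without excluded middle, and with it the
-- Dedekind reals are an instance, unique up to isomorphism.  The inverse is
-- total, with an unspecified value at 0#.
record RealNumbers (c ℓ₁ ℓ₂ : Level) : Set (suc (c ⊔ ℓ₁ ⊔ ℓ₂)) where
  field
    commutativeRing : CommutativeRing c ℓ₁

  open CommutativeRing commutativeRing public

  infix  4 _≤_
  infix  8 _⁻¹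
  field
    _⁻¹             : Carrier → Carrier
    _≤_             : Rel Carrier ℓ₂
    isDecTotalOrder : IsDecTotalOrder _≈_ _≤_
    0≉1             : ¬ 0# ≈ 1#
    ⁻¹-inverseʳ     : ∀ x → ¬ x ≈ 0# → x * x ⁻¹ ≈ 1#
    +-monoʳ-≤       : ∀ z {x y} → x ≤ y → z + x ≤ z + y
    *-nonNeg        : ∀ {x y} → 0# ≤ x → 0# ≤ y → 0# ≤ x * y

  IsUpperBound : ∀ {ℓ} → Pred Carrier ℓ → Carrier → Set _
  IsUpperBound P u = ∀ x → P x → x ≤ u

  field
    complete : (P : Pred Carrier (c ⊔ ℓ₁ ⊔ ℓ₂)) → ∃ P → ∃ (IsUpperBound P) →
               ∃[ s ] (IsUpperBound P s × (∀ u → IsUpperBound P u → s ≤ u))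

  open ToStrict _≈_ _≤_ public using (_<_)

  2# : Carrier
  2# = 1# + 1#

  4# : Carrier
  4# = 2# + 2#

module Scheduling {c ℓ₁ ℓ₂ : Level} (ℝ : RealNumbers c ℓ₁ ℓ₂) where

  open RealNumbers ℝ
  open IsDecTotalOrder isDecTotalOrder using (isTotalOrder)

  -- ℝ ∪ {∞}, with ∞ = ⊤⁺.

  ℝ∞ : Set c
  ℝ∞ = Carrier ⁺

  open AddSupEquality _≈_ public using (_≈⁺_)
  open AddSupNonStrict _≤_ public using (_≤⁺_)

  ≤⁺-totalOrder : TotalOrder _ _ _
  ≤⁺-totalOrder = record
    { isTotalOrder = AddSupNonStrict.≤⁺-isTotalOrder _≤_ isTotalOrder }

  open Max ≤⁺-totalOrder public using () renaming (_⊔_ to _⊔⁺_)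

  infixl 6 _+⁺_
  _+⁺_ : ℝ∞ → ℝ∞ → ℝ∞
  [ x ] +⁺ [ y ] = [ x + y ]
  [ x ] +⁺ ⊤⁺    = ⊤⁺
  ⊤⁺    +⁺ y     = ⊤⁺

  -- Scaling by a positive real; only used with positive factors, so the
  -- convention for 0 · ∞ plays no role.
  infixr 7 _·_
  _·_ : Carrier → ℝ∞ → ℝ∞
  a · [ x ] = [ a * x ]
  a · ⊤⁺    = ⊤⁺

  sum⁺ : ∀ {n} → Vector ℝ∞ n → ℝ∞
  sum⁺ = foldr _+⁺_ [ 0# ]

  -- Only applied to nonnegative values, hence the starting value 0.
  max⁺ : ∀ {n} → Vector ℝ∞ n → ℝ∞
  max⁺ = foldr _⊔⁺_ [ 0# ]

  IsMin : ∀ {ℓ} → Pred ℝ∞ ℓ → ℝ∞ → Set _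
  IsMin P v = P v × (∀ u → P u → v ≤⁺ u)

  IsMax : ∀ {ℓ} → Pred ℝ∞ ℓ → ℝ∞ → Set _
  IsMax P v = P v × (∀ u → P u → u ≤⁺ v)

  record Scenario (m n : ℕ) : Set (c ⊔ ℓ₂) where
    field
      entry  : Fin m → Fin n → ℝ∞
      nonNeg : ∀ i j → [ 0# ] ≤⁺ entry i j

  record Schedule (m n : ℕ) : Set where
    field
      part     : Fin m → Subset n
      covers   : ∀ j → ∃[ i ] j ∈ part i
      disjoint : ∀ {i i′ j} → j ∈ part i → j ∈ part i′ → i ≡ i′

  load : ∀ {m n} → Schedule m n → Scenario m n → Fin m → ℝ∞
  load S q i = sum⁺ λ j → if does (j ∈? part i) then entry i j else [ 0# ]
    where
      open Schedule S
      open Scenario q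

  Cmax : ∀ {m n} → Schedule m n → Scenario m n → ℝ∞
  Cmax S q = max⁺ (load S q)

  IsOPT : ∀ {m n} → Scenario m n → ℝ∞ → Set _
  IsOPT q = IsMin λ v → ∃[ S ] Cmax S q ≈⁺ v

  IsWorstCase : ∀ {m n ℓ} → Pred (Scenario m n) ℓ → Schedule m n → ℝ∞ → Set _
  IsWorstCase 𝓤 S = IsMax λ v → ∃[ q ] (𝓤 q × Cmax S q ≈⁺ v)

  IsOPTrob : ∀ {m n ℓ} → Pred (Scenario m n) ℓ → ℝ∞ → Set _
  IsOPTrob 𝓤 = IsMin λ v → ∃[ S ] IsWorstCase 𝓤 S v

  record Instance (m n : ℕ) : Set (c ⊔ ℓ₁ ⊔ ℓ₂) where
    field
      M        : Fin n → Subset m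
      p⁻ p⁺ w  : Fin n → Carrier
      Γ        : Carrier
      p⁻-nonNeg : ∀ j → 0# ≤ p⁻ j
      p⁻≤p⁺     : ∀ j → p⁻ j ≤ p⁺ j
      w-pos     : ∀ j → 0# < w j
      Γ-nonNeg  : 0# ≤ Γ

  module _ {m n : ℕ} (I : Instance m n) where
    open Instance I

    weight : Subset n → Carrier
    weight T = sum λ j → if does (j ∈? T) then w j else 0#
      where open RawMonoidDefs +-rawMonoid using (sum)

    IsRestrictedAssignment : (Fin n → Carrier) → Scenario m n → Set _
    IsRestrictedAssignment p q =
      ∀ i j → entry i j ≈⁺ (if does (i ∈? M j) then [ p j ] else ⊤⁺)
      where open Scenario q

    BudgetFeasible : (Fin n → Carrier) → Set _
    BudgetFeasible p = ∃[ T ] (weight T ≤ Γ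
                             × (∀ j → j ∉ T → p j ≈ p⁻ j)
                             × (∀ j → j ∈ T → p⁻ j ≤ p j × p j ≤ p⁺ j))

    Uncertainty : Pred (Scenario m n) _
    Uncertainty q = ∃[ p ] (BudgetFeasible p × IsRestrictedAssignment p q)

    WeightsWithinBudget : Set _
    WeightsWithinBudget = ∀ j → 0# < p⁺ j - p⁻ j → w j ≤ Γ

  -- At least one machine: otherwise jobs admit no schedule at all.  The map is
  -- defined on all inputs; guarantees are only claimed for predictions in the
  -- uncertainty set.
  Algorithm : Set _
  Algorithm = ∀ {m n} .{{_ : NonZero m}} →
              Instance m n → Scenario m n → Schedule m n

{-# OPTIONS --safe #-}

-- Let S be optimal for q̂ with value o, and R robustly optimal with value r.
-- Call a job heavy when its density δ j / w j, where δ = p⁺ − p⁻, is at least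
-- 2r / Γ.  In any schedule the light jobs selected by a feasible set deviate by
-- at most 2r in total.  On a machine of R the heavy jobs fit into the budget
-- together: otherwise, as each weight is at most Γ, some of them have total
-- weight in (Γ/2, Γ] and deviate by more than r.  Hence R has makespan at most
-- r for the sizes p′ that are p⁺ on heavy jobs and p⁻ on light ones, and every
-- schedule has worst case at most its p′-makespan plus 2r.
--
-- Now schedule j as in S if o · p′ j ≤ λ · r · p̂ j, and as in R otherwise.  On
-- each machine the kept jobs have p̂-load at most o and p′-load at most λ · r,
-- the moved ones p̂-load at most o / λ and p′-load at most r.  The result has
-- cost at most (1 + 1/λ) · o on q̂ and worst case at most
-- (3 + λ) · r ≤ (4 + 2λ) · r.  (If o = 0, then R itself costs 0 on q̂.)

module Submission where

open import Defs
open import Algebra.Bundles using (CommutativeMonoid)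
import Algebra.Construct.NaturalChoice.Max as Max
import Algebra.Properties.CommutativeSemigroup as CommutativeSemigroupProperties
import Algebra.Properties.Ring as RingProperties
import Algebra.Properties.Semiring.Sum as SemiringSum
import Data.Bool.Base as Bool
open import Data.Bool.Base using (Bool; true; false; if_then_else_)
open import Data.Bool.Properties using () renaming (≤-totalOrder to 𝔹-totalOrder)
open import Data.Fin.Base using (Fin; zero; suc)
open import Data.Fin.Properties using () renaming (_≟_ to _≟ᶠ_)
open import Data.Fin.Subset using (Subset; inside; outside; ⊥; ⁅_⁆; ∁; _∩_; _∪_; _⊆_)
  renaming (_∈_ to _∈ˢ_; _∉_ to _∉ˢ_)
open import Data.Fin.Subset.Properties
  using (_∈?_; ∉⊥; x∈⁅y⁆⇒x≡y; x∈∁p⇒x∉p; x∉p⇒x∈∁p; x∈p∩q⁺; p∩q⊆p; p∩q⊆q; x∈p∪q⁺; x∈p∪q⁻;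
         ⊆-refl; s⊆s; out⊆; in⊆in)
open import Data.Nat.Base as ℕ using (ℕ; NonZero)
open import Data.Product.Base using (Σ; Σ-syntax; ∃; ∃-syntax; _×_; _,_; proj₁; proj₂)
open import Data.Sum.Base using (_⊎_; inj₁; inj₂; [_,_]′)
open import Data.Vec.Base using (Vec; []; _∷_; here; there; lookup; tabulate)
open import Data.Vec.Functional using (Vector)
open import Data.Vec.Properties using (lookup∘tabulate; []=⇒lookup; lookup⇒[]=)
open import Function.Base using (_∘_)
open import Level using (Level)
open import Relation.Binary.Bundles using (Poset; TotalOrder)
import Relation.Binary.Construct.Add.Supremum.NonStrict as AddSupNonStrict
open import Relation.Binary.Construct.Flip.EqAndOrd using () renaming (totalOrder to flipOrder)
open import Relation.Binary.PropositionalEquality.Core as ≡ using (_≡_)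
import Relation.Binary.Reasoning.PartialOrder as PosetReasoning
open import Relation.Binary.Structures using (IsDecTotalOrder)
open import Relation.Nullary.Construct.Add.Supremum using ([_]; ⊤⁺)
open import Relation.Nullary.Decidable.Core using (Dec; does; yes; no; _×-dec_)
open import Relation.Nullary.Negation.Core using (¬_; contradiction)
open import Relation.Unary using (Pred; Decidable; _∈_)

-- Arithmetic in an ordered field.

module OrderedField {c ℓ₁ ℓ₂ : Level} (ℝ : RealNumbers c ℓ₁ ℓ₂) where

  open RealNumbers ℝ
  open IsDecTotalOrder isDecTotalOrder public
    using (_≤?_; _≟_; isTotalOrder)
    renaming (refl to ≤-refl; reflexive to ≤-reflexive; trans to ≤-trans; antisym to ≤-antisym; total to ≤-total)
  open RingProperties ring public using (//-rightDividesˡ)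
  open RingProperties ring using (-1*x≈-x; -‿involutive)

  ≤-poset : Poset _ _ _
  ≤-poset = record { isPartialOrder = IsDecTotalOrder.isPartialOrder isDecTotalOrder }

  open PosetReasoning ≤-poset

  private variable x y z w a : Carrier

  +-mono-≤ : x ≤ y → z ≤ w → x + z ≤ y + w
  +-mono-≤ {x} {y} {z} {w} x≤y z≤w = begin
    x + z ≤⟨ +-monoʳ-≤ x z≤w ⟩
    x + w ≈⟨ +-comm x w ⟩
    w + x ≤⟨ +-monoʳ-≤ w x≤y ⟩
    w + y ≈⟨ +-comm w y ⟩
    y + w ∎

  x≤y⇒0≤y-x : x ≤ y → 0# ≤ y - x
  x≤y⇒0≤y-x {x} {y} x≤y = begin
    0#      ≈⟨ -‿inverseˡ x ⟨
    - x + x ≤⟨ +-monoʳ-≤ (- x) x≤y ⟩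
    - x + y ≈⟨ +-comm (- x) y ⟩
    y - x   ∎

  *-monoʳ-≤ : 0# ≤ a → x ≤ y → a * x ≤ a * y
  *-monoʳ-≤ {a} {x} {y} 0≤a x≤y = begin
    a * x                   ≈⟨ +-identityʳ (a * x) ⟨
    a * x + 0#              ≤⟨ +-monoʳ-≤ (a * x) (*-nonNeg 0≤a (x≤y⇒0≤y-x x≤y)) ⟩
    a * x + a * (y - x)     ≈⟨ distribˡ a x (y - x) ⟨
    a * (x + (y - x))       ≈⟨ *-congˡ (+-comm x (y - x)) ⟩
    a * (y - x + x)         ≈⟨ *-congˡ (//-rightDividesˡ x y) ⟩
    a * y                   ∎

  ≰⇒< : ¬ x ≤ y → y < x
  ≰⇒< {x} {y} x≰y = [ (λ x≤y → contradiction x≤y x≰y) , (λ y≤x → y≤x , x≰y ∘ ≤-reflexive ∘ sym) ]′ (≤-total x y)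

  <-respʳ-≈ : y ≈ z → x < y → x < z
  <-respʳ-≈ y≈z (x≤y , x≉y) = ≤-trans x≤y (≤-reflexive y≈z) , λ x≈z → x≉y (trans x≈z (sym y≈z))

  <-respˡ-≈ : x ≈ y → x < z → y < z
  <-respˡ-≈ x≈y (x≤z , x≉z) = ≤-trans (≤-reflexive (sym x≈y)) x≤z , x≉z ∘ trans x≈y

  <-≤-trans : x < y → y ≤ z → x < z
  <-≤-trans (x≤y , x≉y) y≤z = ≤-trans x≤y y≤z , λ x≈z → x≉y (≤-antisym x≤y (≤-trans y≤z (≤-reflexive (sym x≈z))))

  <⇒≱ : x < y → ¬ y ≤ x
  <⇒≱ (x≤y , x≉y) y≤x = x≉y (≤-antisym x≤y y≤x)

  -- If `y ≤ x`, both products agree by antisymmetry, and multiplying by `a ⁻¹` gives `x ≈ y`.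
  *-cancelˡ-≤ : 0# < a → a * x ≤ a * y → x ≤ y
  *-cancelˡ-≤ {a} {x} {y} (0≤a , 0≉a) ax≤ay = [ (λ x≤y → x≤y) , ≤-reflexive ∘ lemma ]′ (≤-total x y)
    where
    unscale : ∀ z → a ⁻¹ * (a * z) ≈ z
    unscale z = begin-equality
      a ⁻¹ * (a * z) ≈⟨ *-assoc _ _ _ ⟨
      a ⁻¹ * a * z   ≈⟨ *-congʳ (trans (*-comm _ _) (⁻¹-inverseʳ a (0≉a ∘ sym))) ⟩
      1# * z         ≈⟨ *-identityˡ z ⟩
      z              ∎
    lemma : y ≤ x → x ≈ y
    lemma y≤x = trans (sym (unscale x)) (trans (*-congˡ (≤-antisym ax≤ay (*-monoʳ-≤ 0≤a y≤x))) (unscale y))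

  *-cancelˡ-< : 0# ≤ a → a * x < a * y → x < y
  *-cancelˡ-< 0≤a ax<ay = ≰⇒< (<⇒≱ ax<ay ∘ *-monoʳ-≤ 0≤a)

  -- If 1 ≤ 0, then -1 is nonnegative, and so is its square, which is 1.
  0≤1 : 0# ≤ 1#
  0≤1 = [ (λ p → p) , neg ]′ (≤-total 0# 1#)
    where
    neg : 1# ≤ 0# → 0# ≤ 1#
    neg 1≤0 = begin
      0#            ≤⟨ *-nonNeg 0≤-1 0≤-1 ⟩
      - 1# * - 1#   ≈⟨ -1*x≈-x (- 1#) ⟩
      - (- 1#)      ≈⟨ -‿involutive 1# ⟩
      1#            ∎
      where
      0≤-1 : 0# ≤ - 1#
      0≤-1 = ≤-trans (x≤y⇒0≤y-x 1≤0) (≤-reflexive (+-identityˡ (- 1#)))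

  +-nonNeg : 0# ≤ x → 0# ≤ y → 0# ≤ x + y
  +-nonNeg 0≤x 0≤y = ≤-trans (≤-reflexive (sym (+-identityˡ 0#))) (+-mono-≤ 0≤x 0≤y)

  x≤x+y : 0# ≤ y → x ≤ x + y
  x≤x+y {y} {x} 0≤y = ≤-trans (≤-reflexive (sym (+-identityʳ x))) (+-monoʳ-≤ x 0≤y)

  x-y≤x : 0# ≤ y → x - y ≤ x
  x-y≤x {y} {x} 0≤y = ≤-trans (x≤x+y 0≤y) (≤-reflexive (//-rightDividesˡ y x))

  *-pos : 0# < x → 0# < y → 0# < x * y
  *-pos {x} {y} 0<x@(0≤x , _) 0<y@(0≤y , _) = *-nonNeg 0≤x 0≤y , λ 0≈xy →
    <⇒≱ 0<y (*-cancelˡ-≤ 0<x (≤-reflexive (trans (sym 0≈xy) (sym (zeroʳ x)))))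

  ⁻¹-nonNeg : 0# < x → 0# ≤ x ⁻¹
  ⁻¹-nonNeg {x} 0<x@(_ , 0≉x) = *-cancelˡ-≤ 0<x (begin
    x * 0#   ≈⟨ zeroʳ x ⟩
    0#       ≤⟨ 0≤1 ⟩
    1#       ≈⟨ ⁻¹-inverseʳ x (0≉x ∘ sym) ⟨
    x * x ⁻¹ ∎)

  2#*≈+ : ∀ x → 2# * x ≈ x + x
  2#*≈+ x = trans (distribʳ x 1# 1#) (+-cong (*-identityˡ x) (*-identityˡ x))

  2#-pos : 0# < 2#
  2#-pos = +-nonNeg 0≤1 0≤1 , λ 0≈2 → 0≉1 (≤-antisym 0≤1 (≤-trans (x≤x+y 0≤1) (≤-reflexive (sym 0≈2))))

  x≤2#*x : 0# ≤ x → x ≤ 2# * x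
  x≤2#*x {x} 0≤x = ≤-trans (x≤x+y 0≤x) (≤-reflexive (sym (2#*≈+ x)))

-- Sums over subsets and greedy packing.

module FiniteSums {c ℓ₁ ℓ₂ : Level} (ℝ : RealNumbers c ℓ₁ ℓ₂) where

  open RealNumbers ℝ hiding (zero)
  open OrderedField ℝ
  open SemiringSum semiring public using (sum)
  open SemiringSum semiring using (∑-distrib-+; *-distribˡ-sum)
  open PosetReasoning ≤-poset

  private variable
    n : ℕ
    T U V : Subset n
    f g h : Vector Carrier n
    a b : Carrier

  infix 7 _↾_
  -- Shaped like the summands of `weight`, so that `weight I T` and `∑∈ T w` agree by definition.
  _↾_ : Vector Carrier n → Subset n → Vector Carrier n
  (f ↾ T) j = if does (j ∈? T) then f j else 0#

  ∑∈ : Subset n → Vector Carrier n → Carrier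
  ∑∈ T f = sum (f ↾ T)

  sum-mono-≤ : (∀ j → f j ≤ g j) → sum f ≤ sum g
  sum-mono-≤ {ℕ.zero}  f≤g = ≤-refl
  sum-mono-≤ {ℕ.suc n} f≤g = +-mono-≤ (f≤g zero) (sum-mono-≤ (f≤g ∘ suc))

  ∑∈-subadditive : (∀ j → (f ↾ T) j ≤ (g ↾ U) j + (h ↾ V) j) → ∑∈ T f ≤ ∑∈ U g + ∑∈ V h
  ∑∈-subadditive {f = f} {T = T} {g = g} {U = U} {h = h} {V = V} f≤g+h = begin
    ∑∈ T f                            ≤⟨ sum-mono-≤ f≤g+h ⟩
    sum (λ j → (g ↾ U) j + (h ↾ V) j) ≈⟨ ∑-distrib-+ (g ↾ U) (h ↾ V) ⟩
    ∑∈ U g + ∑∈ V h                   ∎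

  -- Comparisons of ratios enter without division, each side carrying one cross-multiplied factor.
  -- Nonnegativity of `g` on `U` pays for the terms outside `T`.
  ∑∈-scaled-mono : T ⊆ U → 0# ≤ b → (∀ j → j ∈ˢ U → 0# ≤ g j) →
                   (∀ j → j ∈ˢ T → a * f j ≤ b * g j) → a * ∑∈ T f ≤ b * ∑∈ U g
  ∑∈-scaled-mono {T = T} {U = U} {b = b} {g = g} {a = a} {f = f} T⊆U 0≤b 0≤g af≤bg = begin
    a * ∑∈ T f                ≈⟨ *-distribˡ-sum a (f ↾ T) ⟩
    sum (λ j → a * (f ↾ T) j) ≤⟨ sum-mono-≤ pointwise ⟩
    sum (λ j → b * (g ↾ U) j) ≈⟨ *-distribˡ-sum b (g ↾ U) ⟨
    b * ∑∈ U g                ∎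
    where
    pointwise : ∀ j → a * (f ↾ T) j ≤ b * (g ↾ U) j
    pointwise j with j ∈? T | j ∈? U
    ... | yes j∈T | yes j∈U = af≤bg j j∈T
    ... | yes j∈T | no  j∉U = contradiction (T⊆U j∈T) j∉U
    ... | no  j∉T | yes j∈U = ≤-trans (≤-reflexive (zeroʳ a)) (*-nonNeg 0≤b (0≤g j j∈U))
    ... | no  j∉T | no  j∉U = ≤-reflexive (trans (zeroʳ a) (sym (zeroʳ b)))

  ∑∈-mono : T ⊆ U → (∀ j → j ∈ˢ U → 0# ≤ g j) → (∀ j → j ∈ˢ T → f j ≤ g j) → ∑∈ T f ≤ ∑∈ U g
  ∑∈-mono {T = T} {U = U} {g = g} {f = f} T⊆U 0≤g f≤g = begin
    ∑∈ T f      ≈⟨ *-identityˡ _ ⟨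
    1# * ∑∈ T f ≤⟨ ∑∈-scaled-mono T⊆U 0≤1 0≤g (λ j → *-monoʳ-≤ 0≤1 ∘ f≤g j) ⟩
    1# * ∑∈ U g ≈⟨ *-identityˡ _ ⟩
    ∑∈ U g      ∎

  ∑∈-⊥ : ∀ n {f : Vector Carrier n} → ∑∈ ⊥ f ≈ 0#
  ∑∈-⊥ ℕ.zero    = refl
  ∑∈-⊥ (ℕ.suc n) = trans (+-identityˡ _) (∑∈-⊥ n)

  ∑∈-⁅⁆ : ∀ (j : Fin n) {f} → ∑∈ ⁅ j ⁆ f ≈ f j
  ∑∈-⁅⁆ {ℕ.suc n} zero    = trans (+-congˡ (∑∈-⊥ n)) (+-identityʳ _)
  ∑∈-⁅⁆ {ℕ.suc n} (suc j) = trans (+-identityˡ _) (∑∈-⁅⁆ j)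

  -- A tail packing above half the budget is left alone; a complete tail is extended by the head if
  -- that fits. Otherwise head and tail together exceed `Γ`, so one of them weighs more than half of
  -- it, and either fits alone.
  greedy : ∀ (w : Vector Carrier n) {Γ} → 0# ≤ Γ → (T : Subset n) → (∀ j → j ∈ˢ T → w j ≤ Γ) →
           ∃[ U ] (U ⊆ T × ∑∈ U w ≤ Γ × (U ≡ T ⊎ Γ < 2# * ∑∈ U w))
  greedy w 0≤Γ [] w≤Γ = [] , ⊆-refl , 0≤Γ , inj₁ ≡.refl
  greedy w {Γ} 0≤Γ (outside ∷ T) w≤Γ with greedy (w ∘ suc) 0≤Γ T (λ j → w≤Γ (suc j) ∘ there)
  ... | U , U⊆T , wU≤Γ , full = outside ∷ U , s⊆s U⊆T , ≤-trans (≤-reflexive (+-identityˡ _)) wU≤Γ ,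
        [ inj₁ ∘ ≡.cong (outside ∷_) , (λ Γ<2wU → inj₂ (<-respʳ-≈ (*-congˡ (sym (+-identityˡ _))) Γ<2wU)) ]′ full
  greedy w {Γ} 0≤Γ (inside ∷ T) w≤Γ with greedy (w ∘ suc) 0≤Γ T (λ j → w≤Γ (suc j) ∘ there)
  ... | U , U⊆T , wU≤Γ , inj₂ Γ<2wU = outside ∷ U , out⊆ U⊆T , ≤-trans (≤-reflexive (+-identityˡ _)) wU≤Γ ,
        inj₂ (<-respʳ-≈ (*-congˡ (sym (+-identityˡ _))) Γ<2wU)
  ... | U , U⊆T , wU≤Γ , inj₁ ≡.refl with w zero + ∑∈ U (w ∘ suc) ≤? Γ | 2# * w zero ≤? Γ | 2# * ∑∈ U (w ∘ suc) ≤? Γ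
  ... | yes p | _ | _ = inside ∷ U , ⊆-refl , p , inj₁ ≡.refl
  ... | no _  | no Γ≱2w₀ | _ = ⁅ zero ⁆ , in⊆in (λ j∈⊥ → contradiction j∈⊥ ∉⊥) ,
        ≤-trans (≤-reflexive (∑∈-⁅⁆ zero {w})) (w≤Γ zero here) ,
        inj₂ (<-respʳ-≈ (*-congˡ (sym (∑∈-⁅⁆ zero {w}))) (≰⇒< Γ≱2w₀))
  ... | no _  | yes _ | no Γ≱2wU = outside ∷ U , out⊆ ⊆-refl , ≤-trans (≤-reflexive (+-identityˡ _)) wU≤Γ ,
        inj₂ (<-respʳ-≈ (*-congˡ (sym (+-identityˡ _))) (≰⇒< Γ≱2wU))
  ... | no p  | yes 2w₀≤Γ | yes 2wU≤Γ = contradiction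
        (*-cancelˡ-≤ 2#-pos (begin
          2# * (w zero + ∑∈ U (w ∘ suc))      ≈⟨ distribˡ 2# _ _ ⟩
          2# * w zero + 2# * ∑∈ U (w ∘ suc)   ≤⟨ +-mono-≤ 2w₀≤Γ 2wU≤Γ ⟩
          Γ + Γ                               ≈⟨ 2#*≈+ Γ ⟨
          2# * Γ                              ∎)) p

  ∑∈-∪ : (∀ j → 0# ≤ f j) → ∑∈ (U ∪ V) f ≤ ∑∈ U f + ∑∈ V f
  ∑∈-∪ {f = f} {U = U} {V = V} 0≤f = ∑∈-subadditive pointwise
    where
    pointwise : ∀ j → (f ↾ (U ∪ V)) j ≤ (f ↾ U) j + (f ↾ V) j
    pointwise j with j ∈? (U ∪ V) | j ∈? U | j ∈? V
    ... | yes _   | yes _   | yes _   = x≤x+y (0≤f j)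
    ... | yes _   | yes _   | no  _   = ≤-reflexive (sym (+-identityʳ (f j)))
    ... | yes _   | no  _   | yes _   = ≤-reflexive (sym (+-identityˡ (f j)))
    ... | yes j∈∪ | no  j∉U | no  j∉V = contradiction (x∈p∪q⁻ U V j∈∪) [ j∉U , j∉V ]′
    ... | no  _   | yes _   | yes _   = +-nonNeg (0≤f j) (0≤f j)
    ... | no  _   | yes _   | no  _   = +-nonNeg (0≤f j) ≤-refl
    ... | no  _   | no  _   | yes _   = +-nonNeg ≤-refl (0≤f j)
    ... | no  _   | no  _   | no  _   = +-nonNeg ≤-refl ≤-refl

-- Minimisation over finite types.

module Minimisation {c ℓ₁ ℓ₂ : Level} (O : TotalOrder c ℓ₁ ℓ₂) where

  open TotalOrder O

  -- Compactness of `A`, quantified over all functions so that it passes to vectors over `A`.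
  -- Flipping the order turns it into maximisation.
  Minimisable : ∀ {a} → Set a → Set _
  Minimisable A = (f : A → Carrier) → ∃[ x ] (∀ y → f x ≤ f y)

  Bool-minimisable : Minimisable Bool
  Bool-minimisable f with total (f false) (f true)
  ... | inj₁ f≤t = false , λ { false → refl ; true → f≤t }
  ... | inj₂ t≤f = true  , λ { false → t≤f ; true → refl }

  Fin-minimisable : ∀ m .{{_ : NonZero m}} → Minimisable (Fin m)
  Fin-minimisable (ℕ.suc ℕ.zero)       f = zero , λ { zero → refl }
  Fin-minimisable (ℕ.suc m@(ℕ.suc _)) f with Fin-minimisable m (f ∘ suc)
  ... | i , fi≤ with total (f zero) (f (suc i))
  ...   | inj₁ f0≤ = zero  , λ { zero → refl ; (suc j) → trans f0≤ (fi≤ j) }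
  ...   | inj₂ ≤f0 = suc i , λ { zero → ≤f0  ; (suc j) → fi≤ j }

  -- The tail is minimised separately for each head, then the resulting values over the heads.
  Vec-minimisable : ∀ {a} {A : Set a} → Minimisable A → ∀ n → Minimisable (Vec A n)
  Vec-minimisable A-min ℕ.zero    f = [] , λ { [] → refl }
  Vec-minimisable A-min (ℕ.suc n) f =
    x ∷ proj₁ (tails x) , λ { (y ∷ ys) → trans (x-min y) (proj₂ (tails y) ys) }
    where
    tails = λ x → Vec-minimisable A-min n (f ∘ (x ∷_))
    open Σ (A-min (λ x → f (x ∷ proj₁ (tails x)))) renaming (proj₁ to x; proj₂ to x-min)

-- Subsets and searches from decidable predicates.

module _ {n p} {P : Pred (Fin n) p} (P? : Decidable P) where

  subset : Subset n
  subset = tabulate (does ∘ P?)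

  ∈-subset⁺ : ∀ {j} → P j → j ∈ˢ subset
  ∈-subset⁺ {j} Pj with P? j in eq
  ... | yes _  = lookup⇒[]= j subset (≡.trans (lookup∘tabulate _ j) (≡.cong does eq))
  ... | no ¬Pj = contradiction Pj ¬Pj

  ∈-subset⁻ : ∀ {j} → j ∈ˢ subset → P j
  ∈-subset⁻ {j} j∈ with P? j in eq
  ... | yes Pj = Pj
  ... | no _   with ≡.trans (≡.sym ([]=⇒lookup j∈)) (≡.trans (lookup∘tabulate _ j) (≡.cong does eq))
  ...   | ()

open Minimisation (flipOrder 𝔹-totalOrder) using () renaming (Minimisable to Searchable)

-- `Searchable` is maximisation of Boolean functions. A maximiser of `does ∘ P?` satisfies `P` as
-- soon as anything does, and it exists even when nothing does.
find : ∀ {a p} {A : Set a} {P : Pred A p} → Searchable A → Decidable P → ∃[ x ] (∃ P → P x)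
find {P = P} A-search P? = x , λ { (y , Py) → found Py (x-max y) }
  where
  open Σ (A-search (does ∘ P?)) renaming (proj₁ to x; proj₂ to x-max)
  found : ∀ {y} → P y → does (P? y) Bool.≤ does (P? x) → P x
  found {y} Py y≤x with P? y | P? x
  found Py _  | _      | yes Px = Px
  found Py _  | no ¬Py | no _   = contradiction Py ¬Py
  found Py () | yes _  | no _

module Makespan {c ℓ₁ ℓ₂ : Level} (ℝ : RealNumbers c ℓ₁ ℓ₂) where

  open RealNumbers ℝ hiding (zero)
  open OrderedField ℝ
  open FiniteSums ℝ
  open Scheduling ℝ
  open AddSupNonStrict _≤_ using ([_]; _≤⊤⁺; [≤]-injective; ≤⁺-dec)
  open TotalOrder ≤⁺-totalOrder using () renaming (refl to ≤⁺-refl; reflexive to ≤⁺-reflexive; trans to ≤⁺-trans)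
  open TotalOrder.Eq ≤⁺-totalOrder using () renaming (refl to ≈⁺-refl; reflexive to ≈⁺-reflexive; sym to ≈⁺-sym)
  open Max ≤⁺-totalOrder using (⊔-mono-≤; ⊔-lub; x≤x⊔y; x≤y⊔x)

  private variable m n : ℕ

  -- Sums and maxima in the extended reals.

  sum⁺-mono : {f g : Vector ℝ∞ n} → (∀ j → f j ≤⁺ g j) → sum⁺ f ≤⁺ sum⁺ g
  sum⁺-mono {ℕ.zero}  f≤g = ≤⁺-refl
  sum⁺-mono {ℕ.suc n} f≤g = +⁺-mono (f≤g zero) (sum⁺-mono (f≤g ∘ suc))
    where
    +⁺-mono : ∀ {x y z w} → x ≤⁺ y → z ≤⁺ w → x +⁺ z ≤⁺ y +⁺ w
    +⁺-mono [ x≤y ]   [ z≤w ]   = [ +-mono-≤ x≤y z≤w ]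
    +⁺-mono [ x≤y ]   (_ ≤⊤⁺)   = _ ≤⊤⁺
    +⁺-mono (_ ≤⊤⁺)   _         = _ ≤⊤⁺

  sum⁺-finite : (f : Vector Carrier n) → sum⁺ (λ j → [ f j ]) ≡ [ sum f ]
  sum⁺-finite {ℕ.zero}  f = ≡.refl
  sum⁺-finite {ℕ.suc n} f = ≡.cong ([ f zero ] +⁺_) (sum⁺-finite (f ∘ suc))

  sum⁺-infinite : {f : Vector ℝ∞ n} → ∀ j → f j ≡ ⊤⁺ → sum⁺ f ≡ ⊤⁺
  sum⁺-infinite {f = f} zero    f₀≡⊤ = ≡.cong (_+⁺ sum⁺ (f ∘ suc)) f₀≡⊤
  sum⁺-infinite {f = f} (suc j) fⱼ≡⊤ = ≡.trans (≡.cong (f zero +⁺_) (sum⁺-infinite j fⱼ≡⊤)) (+⁺-zeroʳ (f zero))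
    where
    +⁺-zeroʳ : ∀ x → x +⁺ ⊤⁺ ≡ ⊤⁺
    +⁺-zeroʳ [ x ] = ≡.refl
    +⁺-zeroʳ ⊤⁺    = ≡.refl

  max⁺-mono : {f g : Vector ℝ∞ n} → (∀ i → f i ≤⁺ g i) → max⁺ f ≤⁺ max⁺ g
  max⁺-mono {ℕ.zero}  f≤g = ≤⁺-refl
  max⁺-mono {ℕ.suc n} f≤g = ⊔-mono-≤ (f≤g zero) (max⁺-mono (f≤g ∘ suc))

  x≤max⁺ : (f : Vector ℝ∞ n) → ∀ i → f i ≤⁺ max⁺ f
  x≤max⁺ f zero    = x≤x⊔y (f zero) _
  x≤max⁺ f (suc i) = ≤⁺-trans (x≤max⁺ (f ∘ suc) i) (x≤y⊔x (f zero) _)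

  max⁺-nonNeg : (f : Vector ℝ∞ n) → [ 0# ] ≤⁺ max⁺ f
  max⁺-nonNeg {ℕ.zero}  f = ≤⁺-refl
  max⁺-nonNeg {ℕ.suc n} f = ≤⁺-trans (max⁺-nonNeg (f ∘ suc)) (x≤y⊔x (f zero) _)

  max⁺-lub : {f : Vector ℝ∞ n} → ∀ {v} → [ 0# ] ≤⁺ v → (∀ i → f i ≤⁺ v) → max⁺ f ≤⁺ v
  max⁺-lub {ℕ.zero}  0≤v f≤v = 0≤v
  max⁺-lub {ℕ.suc n} 0≤v f≤v = ⊔-lub (f≤v zero) (max⁺-lub 0≤v (f≤v ∘ suc))

  -- Schedules as assignment vectors, and optimal schedules.

  open Schedule
  open Scenario

  load-mono : ∀ (S S′ : Schedule m n) (q q′ : Scenario m n) {i} → part S i ⊆ part S′ i →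
              (∀ j → j ∈ˢ part S i → entry q i j ≤⁺ entry q′ i j) → load S q i ≤⁺ load S′ q′ i
  load-mono S S′ q q′ {i} S⊆S′ q≤q′ = sum⁺-mono pointwise
    where
    pointwise : ∀ j → (if does (j ∈? part S i) then entry q i j else [ 0# ]) ≤⁺
                      (if does (j ∈? part S′ i) then entry q′ i j else [ 0# ])
    pointwise j with j ∈? part S i | j ∈? part S′ i
    ... | yes j∈S | yes _    = q≤q′ j j∈S
    ... | yes j∈S | no  j∉S′ = contradiction (S⊆S′ j∈S) j∉S′
    ... | no  _   | yes _    = nonNeg q′ i j
    ... | no  _   | no  _    = ≤⁺-refl

  Cmax-mono : ∀ (S S′ : Schedule m n) (q q′ : Scenario m n) → (∀ i → part S i ⊆ part S′ i) →
              (∀ i j → entry q i j ≤⁺ entry q′ i j) → Cmax S q ≤⁺ Cmax S′ q′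
  Cmax-mono S S′ q q′ S⊆S′ q≤q′ =
    max⁺-mono (λ i → load-mono S S′ q q′ (S⊆S′ i) (λ j _ → q≤q′ i j))

  fromAssignment : Vec (Fin m) n → Schedule m n
  fromAssignment σ = record
    { part     = λ i → subset (λ j → lookup σ j ≟ᶠ i)
    ; covers   = λ j → lookup σ j , ∈-subset⁺ (λ j → lookup σ j ≟ᶠ _) ≡.refl
    ; disjoint = λ {i} {i′} j∈i j∈i′ → ≡.trans
        (≡.sym (∈-subset⁻ (λ j → lookup σ j ≟ᶠ i) j∈i)) (∈-subset⁻ (λ j → lookup σ j ≟ᶠ i′) j∈i′)
    }

  assignment : Schedule m n → Vec (Fin m) n
  assignment S = tabulate (proj₁ ∘ covers S)

  part-assignment : ∀ (S : Schedule m n) i → part (fromAssignment (assignment S)) i ⊆ part S i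
  part-assignment S i {j} j∈i = ≡.subst (λ i → j ∈ˢ part S i)
    (≡.trans (≡.sym (lookup∘tabulate (proj₁ ∘ covers S) j)) (∈-subset⁻ (λ j → lookup (assignment S) j ≟ᶠ i) j∈i))
    (proj₂ (covers S j))

  -- Every schedule is matched by one that comes from a vector of machines, so the search for an
  -- optimum may run over finitely many vectors.
  Cmax-assignment : ∀ (S : Schedule m n) q → Cmax (fromAssignment (assignment S)) q ≤⁺ Cmax S q
  Cmax-assignment S q = Cmax-mono (fromAssignment (assignment S)) S q q (part-assignment S) (λ _ _ → ≤⁺-refl)

  splice : Subset n → Schedule m n → Schedule m n → Schedule m n
  splice K S R = record
    { part     = λ i → (part S i ∩ K) ∪ (part R i ∩ ∁ K)
    ; covers   = covered
    ; disjoint = λ {i} {i′} {j} j∈i j∈i′ → unique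
        (x∈p∪q⁻ (part S i ∩ K) (part R i ∩ ∁ K) j∈i) (x∈p∪q⁻ (part S i′ ∩ K) (part R i′ ∩ ∁ K) j∈i′)
    }
    where
    covered : ∀ j → ∃[ i ] j ∈ˢ ((part S i ∩ K) ∪ (part R i ∩ ∁ K))
    covered j with j ∈? K
    ... | yes j∈K = proj₁ (covers S j) , x∈p∪q⁺ (inj₁ (x∈p∩q⁺ (proj₂ (covers S j) , j∈K)))
    ... | no  j∉K = proj₁ (covers R j) , x∈p∪q⁺ (inj₂ (x∈p∩q⁺ (proj₂ (covers R j) , x∉p⇒x∈∁p j∉K)))
    unique : ∀ {i i′ j} → j ∈ˢ (part S i ∩ K) ⊎ j ∈ˢ (part R i ∩ ∁ K) →
             j ∈ˢ (part S i′ ∩ K) ⊎ j ∈ˢ (part R i′ ∩ ∁ K) → i ≡ i′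
    unique (inj₁ p) (inj₁ q) = disjoint S (p∩q⊆p _ K p) (p∩q⊆p _ K q)
    unique (inj₁ p) (inj₂ q) = contradiction (p∩q⊆q _ K p) (x∈∁p⇒x∉p (p∩q⊆q _ (∁ K) q))
    unique (inj₂ p) (inj₁ q) = contradiction (p∩q⊆q _ K q) (x∈∁p⇒x∉p (p∩q⊆q _ (∁ K) p))
    unique (inj₂ p) (inj₂ q) = disjoint R (p∩q⊆p _ (∁ K) p) (p∩q⊆p _ (∁ K) q)

  module _ {m n : ℕ} .{{_ : NonZero m}} where
    open Minimisation ≤⁺-totalOrder using (Fin-minimisable; Vec-minimisable)

    -- Kept general in the cost `f` to serve both the nominal and the robust optimum.
    optimal : (f : Schedule m n → ℝ∞) → ∃[ S ] (∀ σ → f S ≤⁺ f (fromAssignment σ))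
    optimal f = let σ , σ-min = Vec-minimisable (Fin-minimisable m) n (f ∘ fromAssignment)
                in fromAssignment σ , σ-min

    optimal-isOPT : ∀ q → IsOPT q (Cmax (proj₁ (optimal (λ S → Cmax S q))) q)
    optimal-isOPT q = let S , S-min = optimal (λ S → Cmax S q) in
      (S , ≈⁺-refl) ,
      λ u (S′ , S′≈u) → ≤⁺-trans (S-min (assignment S′)) (≤⁺-trans (Cmax-assignment S′ q) (≤⁺-reflexive S′≈u))

  -- Restricted assignment and worst cases under budget uncertainty.

  module Uncertain {m n : ℕ} (I : Instance m n) where
    open Instance I

    Eligible : Schedule m n → Set
    Eligible S = ∀ i j → j ∈ˢ part S i → i ∈ˢ M j

    module _ {p : Fin n → Carrier} {q : Scenario m n} (q-p : IsRestrictedAssignment I p q) (S : Schedule m n) where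

      entry-ineligible : ∀ {i j} → i ∉ˢ M j → entry q i j ≡ ⊤⁺
      entry-ineligible {i} {j} i∉M with i ∈? M j | entry q i j | q-p i j
      ... | yes i∈M | _  | _ = contradiction i∈M i∉M
      ... | no  _   | ⊤⁺ | _ = ≡.refl

      load-ineligible : ∀ {i j} → j ∈ˢ part S i → i ∉ˢ M j → load S q i ≡ ⊤⁺
      load-ineligible {i} {j} j∈S i∉M = sum⁺-infinite j summand
        where
        summand : (if does (j ∈? part S i) then entry q i j else [ 0# ]) ≡ ⊤⁺
        summand with j ∈? part S i
        ... | yes _   = entry-ineligible i∉M
        ... | no  j∉S = contradiction j∈S j∉S

      -- An ineligible job puts `⊤⁺` on its machine, which absorbs the rest of the load; a finite
      -- makespan rules this out.
      Cmax≤⁻-eligible : ∀ {v} → Cmax S q ≤⁺ [ v ] → Eligible S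
      Cmax≤⁻-eligible {v} C≤v i j j∈S with i ∈? M j
      ... | yes i∈M = i∈M
      ... | no  i∉M with ≡.subst (_≤⁺ [ v ]) (load-ineligible j∈S i∉M) (≤⁺-trans (x≤max⁺ (load S q) i) C≤v)
      ...   | ()

      entry-eligible : Eligible S → ∀ i j → j ∈ˢ part S i → entry q i j ≈⁺ [ p j ]
      entry-eligible el i j j∈S with i ∈? M j | q-p i j
      ... | yes _   | q≈p = q≈p
      ... | no  i∉M | _   = contradiction (el i j j∈S) i∉M

      load-eligible : Eligible S → ∀ i → load S q i ≤⁺ [ ∑∈ (part S i) p ] × [ ∑∈ (part S i) p ] ≤⁺ load S q i
      load-eligible el i =
        ≡.subst (load S q i ≤⁺_) (sum⁺-finite (p ↾ part S i)) (sum⁺-mono (proj₁ ∘ pointwise)) ,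
        ≡.subst (_≤⁺ load S q i) (sum⁺-finite (p ↾ part S i)) (sum⁺-mono (proj₂ ∘ pointwise))
        where
        pointwise : ∀ j → let x = if does (j ∈? part S i) then entry q i j else [ 0# ] in
                          x ≤⁺ [ (p ↾ part S i) j ] × [ (p ↾ part S i) j ] ≤⁺ x
        pointwise j with j ∈? part S i
        ... | yes j∈S = ≤⁺-reflexive (entry-eligible el i j j∈S) , ≤⁺-reflexive (≈⁺-sym (entry-eligible el i j j∈S))
        ... | no  _   = ≤⁺-refl , ≤⁺-refl

      Cmax≤⁻ : ∀ {v} → Cmax S q ≤⁺ [ v ] → ∀ i → ∑∈ (part S i) p ≤ v
      Cmax≤⁻ C≤v i = [≤]-injective (≤⁺-trans (proj₂ (load-eligible (Cmax≤⁻-eligible C≤v) i))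
        (≤⁺-trans (x≤max⁺ (load S q) i) C≤v))

      Cmax≤⁺ : ∀ {v} → 0# ≤ v → Eligible S → (∀ i → ∑∈ (part S i) p ≤ v) → Cmax S q ≤⁺ [ v ]
      Cmax≤⁺ 0≤v el loads = max⁺-lub [ 0≤v ] (λ i → ≤⁺-trans (proj₁ (load-eligible el i)) [ loads i ])

    sizes : Subset n → Fin n → Carrier
    sizes T j = if does (j ∈? T) then p⁺ j else p⁻ j

    p⁻≤sizes : ∀ T j → p⁻ j ≤ sizes T j
    p⁻≤sizes T j with j ∈? T
    ... | yes _ = p⁻≤p⁺ j
    ... | no  _ = ≤-refl

    sizes-nonNeg : ∀ T j → 0# ≤ sizes T j
    sizes-nonNeg T j = ≤-trans (p⁻-nonNeg j) (p⁻≤sizes T j)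

    scenario : Subset n → Scenario m n
    scenario T = record
      { entry  = λ i j → if does (i ∈? M j) then [ sizes T j ] else ⊤⁺
      ; nonNeg = nonNeg′
      }
      where
      nonNeg′ : ∀ i j → [ 0# ] ≤⁺ (if does (i ∈? M j) then [ sizes T j ] else ⊤⁺)
      nonNeg′ i j with i ∈? M j
      ... | yes _ = [ sizes-nonNeg T j ]
      ... | no  _ = _ ≤⊤⁺

    scenario-restricted : ∀ T → IsRestrictedAssignment I (sizes T) (scenario T)
    scenario-restricted T i j = ≈⁺-refl

    sizes-feasible : ∀ {T} → weight I T ≤ Γ → BudgetFeasible I (sizes T)
    sizes-feasible {T} wT≤Γ = T , wT≤Γ , off , on
      where
      off : ∀ j → j ∉ˢ T → sizes T j ≈ p⁻ j
      off j j∉T with j ∈? T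
      ... | yes j∈T = contradiction j∈T j∉T
      ... | no  _   = refl
      on : ∀ j → j ∈ˢ T → p⁻ j ≤ sizes T j × sizes T j ≤ p⁺ j
      on j j∈T with j ∈? T
      ... | yes _   = p⁻≤p⁺ j , ≤-refl
      ... | no  j∉T = contradiction j∈T j∉T

    -- Raising each deviating job to `p⁺` dominates the vector, which reduces worst cases to the
    -- finitely many `sizes T`.
    feasible-bounds : ∀ {p} (pf : BudgetFeasible I p) → ∀ j → p⁻ j ≤ p j × p j ≤ sizes (proj₁ pf) j
    feasible-bounds (T , _ , off , on) j with j ∈? T
    ... | yes j∈T = on j j∈T
    ... | no  j∉T = ≤-reflexive (sym (off j j∉T)) , ≤-reflexive (off j j∉T)

    -- Over budget, fall back to ∅: the worst case can then be sought among all subsets.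
    clip : Subset n → Subset n
    clip T = if does (weight I T ≤? Γ) then T else ⊥

    weight-clip : ∀ T → weight I (clip T) ≤ Γ
    weight-clip T with weight I T ≤? Γ
    ... | yes wT≤Γ = wT≤Γ
    ... | no  _    = ≤-trans (≤-reflexive (∑∈-⊥ n)) Γ-nonNeg

    clip-feasible : ∀ T → weight I T ≤ Γ → clip T ≡ T
    clip-feasible T wT≤Γ with weight I T ≤? Γ
    ... | yes _   = ≡.refl
    ... | no  wT≰ = contradiction wT≤Γ wT≰

    open Minimisation (flipOrder ≤⁺-totalOrder) using (Bool-minimisable; Vec-minimisable)

    module _ (S : Schedule m n) where

      private
        argmax : ∃[ T ] (∀ T′ → Cmax S (scenario (clip T′)) ≤⁺ Cmax S (scenario (clip T)))
        -- The order is flipped, so this minimiser over subsets, read as Boolean vectors, is a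
        -- maximiser of the cost.
        argmax = Vec-minimisable Bool-minimisable n (λ T → Cmax S (scenario (clip T)))

      worstSet : Subset n
      worstSet = clip (proj₁ argmax)

      weight-worstSet : weight I worstSet ≤ Γ
      weight-worstSet = weight-clip (proj₁ argmax)

      worst : ℝ∞
      worst = Cmax S (scenario worstSet)

      scenario≤worst : ∀ T → weight I T ≤ Γ → Cmax S (scenario T) ≤⁺ worst
      scenario≤worst T wT≤Γ = ≡.subst (λ T → Cmax S (scenario T) ≤⁺ worst) (clip-feasible T wT≤Γ) (proj₂ argmax T)

      worst∈𝓤 : scenario worstSet ∈ Uncertainty I
      worst∈𝓤 = sizes worstSet , sizes-feasible weight-worstSet , scenario-restricted worstSet

      uncertain≤worst : ∀ {q} → q ∈ Uncertainty I → Cmax S q ≤⁺ worst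
      uncertain≤worst {q} (p , pf , q-p) =
        ≤⁺-trans (Cmax-mono S S q (scenario T) (λ _ → ⊆-refl) dominated) (scenario≤worst T (proj₁ (proj₂ pf)))
        where
        T = proj₁ pf
        dominated : ∀ i j → entry q i j ≤⁺ entry (scenario T) i j
        dominated i j with i ∈? M j | q-p i j
        ... | yes _ | q≈p = ≤⁺-trans (≤⁺-reflexive q≈p) [ proj₂ (feasible-bounds {p} pf j) ]
        ... | no  _ | _   = _ ≤⊤⁺

      worst-isWorstCase : IsWorstCase (Uncertainty I) S worst
      worst-isWorstCase = (scenario worstSet , worst∈𝓤 , ≈⁺-refl) ,
        λ u (q , q∈𝓤 , q≈u) → ≤⁺-trans (≤⁺-reflexive (≈⁺-sym q≈u)) (uncertain≤worst {q} q∈𝓤)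

    -- Reads a finite worst case as real inequalities, one for each machine and affordable set;
    -- `worst≤⁺` is the way back.
    worst≤⁻ : ∀ S {r} → worst S ≤⁺ [ r ] → Eligible S × (∀ i T → weight I T ≤ Γ → ∑∈ (part S i) (sizes T) ≤ r)
    worst≤⁻ S W≤r =
      Cmax≤⁻-eligible {sizes (worstSet S)} {scenario (worstSet S)} (scenario-restricted (worstSet S)) S W≤r ,
      λ i T wT≤Γ → Cmax≤⁻ {sizes T} {scenario T} (scenario-restricted T) S (≤⁺-trans (scenario≤worst S T wT≤Γ) W≤r) i

    worst≤⁺ : ∀ S {v} → 0# ≤ v → Eligible S →
              (∀ i T → weight I T ≤ Γ → ∑∈ (part S i) (sizes T) ≤ v) → worst S ≤⁺ [ v ]
    worst≤⁺ S 0≤v el loads = Cmax≤⁺ {sizes T} {scenario T} (scenario-restricted T) S 0≤v el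
      (λ i → loads i T (weight-worstSet S))
      where T = worstSet S

    optimal-isOPTrob : .{{_ : NonZero m}} → IsOPTrob (Uncertainty I) (worst (proj₁ (optimal worst)))
    optimal-isOPTrob = let R , R-min = optimal worst in
      (R , worst-isWorstCase R) ,
      -- A competitor `S` is first turned into an enumerated schedule `S′`. The worst scenario of
      -- `S′` lies in the uncertainty set, so the worst case of `S` covers it.
      λ u (S , _ , S-max) → let S′ = fromAssignment (assignment S) in
        ≤⁺-trans (R-min (assignment S)) (≤⁺-trans (Cmax-assignment S (scenario (worstSet S′)))
          (S-max _ (scenario (worstSet S′) , worst∈𝓤 S′ , ≈⁺-refl)))

    -- Heavy and light jobs.

    δ : Fin n → Carrier
    δ j = p⁺ j - p⁻ j

    δ-nonNeg : ∀ j → 0# ≤ δ j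
    δ-nonNeg j = x≤y⇒0≤y-x (p⁻≤p⁺ j)

    w-nonNeg : ∀ j → 0# ≤ w j
    w-nonNeg j = proj₁ (w-pos j)

    -- δ j / w j ≥ 2r / Γ, multiplied out to make sense for Γ = 0.
    Heavy? : ∀ r j → Dec ((2# * r) * w j ≤ Γ * δ j)
    Heavy? r j = (2# * r) * w j ≤? Γ * δ j

    heavy : Carrier → Subset n
    heavy r = subset (Heavy? r)

    δ≤sizes : ∀ {T j} → j ∈ˢ T → δ j ≤ sizes T j
    δ≤sizes {T} {j} j∈T with j ∈? T
    ... | yes _   = x-y≤x (p⁻-nonNeg j)
    ... | no  j∉T = contradiction j∈T j∉T

    -- Restricting the deviating set to the jobs of one machine does not lower its load, so only the
    -- heavy jobs of that machine have to fit into the budget.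
    sizes-∩ : ∀ {T U j} → j ∈ˢ U → sizes T j ≤ sizes (U ∩ T) j
    sizes-∩ {T} {U} {j} j∈U with j ∈? T | j ∈? (U ∩ T)
    ... | yes _   | yes _ = ≤-refl
    ... | yes j∈T | no j∉ = contradiction (x∈p∩q⁺ (j∈U , j∈T)) j∉
    ... | no  _   | yes _ = p⁻≤p⁺ j
    ... | no  _   | no  _ = ≤-refl

    open PosetReasoning ≤-poset
    open CommutativeSemigroupProperties (CommutativeMonoid.commutativeSemigroup *-commutativeMonoid)
      using (interchange; x∙yz≈y∙xz)

    module _ (withinBudget : WeightsWithinBudget I) where

      -- Since `r` and `w j` are positive, heaviness forces `Γ * δ j` and hence `δ j` to be
      -- positive, and the hypothesis on weights applies.
      heavy-weight≤Γ : ∀ {r} → 0# < r → ∀ j → j ∈ˢ heavy r → w j ≤ Γ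
      heavy-weight≤Γ {r} 0<r j j∈H = withinBudget j (*-cancelˡ-< Γ-nonNeg
        (<-≤-trans (<-respˡ-≈ (sym (zeroʳ Γ)) (*-pos (*-pos 2#-pos 0<r) (w-pos j))) (∈-subset⁻ (Heavy? r) j∈H)))

      -- Either the greedy packing takes all heavy jobs of `U`, and `loads` applies, or it yields
      -- `T` with `Γ < 2# * ∑∈ T w`. Then heaviness and the load bound give
      -- `2# * r * ∑∈ T w ≤ Γ * r`, a contradiction after cancelling `r`.
      heavy-load : ∀ {r} (U : Subset n) → 0# < r → (∀ T → weight I T ≤ Γ → ∑∈ U (sizes T) ≤ r) →
                   ∑∈ U (sizes (heavy r)) ≤ r
      heavy-load {r} U 0<r loads with greedy w Γ-nonNeg (U ∩ heavy r) (λ j → heavy-weight≤Γ 0<r j ∘ p∩q⊆q U (heavy r))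
      ... | .(U ∩ heavy r) , _ , wT≤Γ , inj₁ ≡.refl = ≤-trans
        (∑∈-mono ⊆-refl (λ j _ → sizes-nonNeg _ j) (λ j → sizes-∩)) (loads _ wT≤Γ)
      ... | T , T⊆ , wT≤Γ , inj₂ Γ<2wT = contradiction
        (*-cancelˡ-≤ 0<r (begin
          r * (2# * ∑∈ T w)  ≈⟨ x∙yz≈y∙xz r 2# _ ⟩
          2# * (r * ∑∈ T w)  ≈⟨ *-assoc 2# r _ ⟨
          2# * r * ∑∈ T w    ≤⟨ ∑∈-scaled-mono ⊆-refl Γ-nonNeg (λ j _ → δ-nonNeg j)
                                 (λ j → ∈-subset⁻ (Heavy? r) ∘ p∩q⊆q U (heavy r) ∘ T⊆) ⟩
          Γ * ∑∈ T δ         ≤⟨ *-monoʳ-≤ Γ-nonNeg (∑∈-mono (p∩q⊆p U (heavy r) ∘ T⊆)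
                                 (λ j _ → sizes-nonNeg T j) (λ j → δ≤sizes)) ⟩
          Γ * ∑∈ U (sizes T) ≤⟨ *-monoʳ-≤ Γ-nonNeg (loads T wT≤Γ) ⟩
          Γ * r              ≈⟨ *-comm Γ r ⟩
          r * Γ              ∎))
        (<⇒≱ Γ<2wT)

      -- For positive `Γ`, lightness bounds `Γ` times the total deviation by `2# * r` times the
      -- weight of `T`, which is at most `Γ`; then `Γ` cancels.
      light-deviation : ∀ {r} → 0# ≤ r → ∀ T → weight I T ≤ Γ → ∑∈ (T ∩ ∁ (heavy r)) δ ≤ 2# * r
      light-deviation {r} 0≤r T wT≤Γ with Γ ≤? 0#
      ... | no Γ≰0 = *-cancelˡ-≤ (≰⇒< Γ≰0) (begin
        Γ * ∑∈ (T ∩ ∁ (heavy r)) δ ≤⟨ ∑∈-scaled-mono (p∩q⊆p T _) 0≤2r (λ j _ → w-nonNeg j) light ⟩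
        2# * r * ∑∈ T w            ≤⟨ *-monoʳ-≤ 0≤2r wT≤Γ ⟩
        2# * r * Γ                 ≈⟨ *-comm _ Γ ⟩
        Γ * (2# * r)               ∎)
        where
        0≤2r = *-nonNeg (proj₁ 2#-pos) 0≤r
        light : ∀ j → j ∈ˢ (T ∩ ∁ (heavy r)) → Γ * δ j ≤ 2# * r * w j
        light j j∈ = proj₁ (≰⇒< (x∈∁p⇒x∉p (p∩q⊆q T _ j∈) ∘ ∈-subset⁺ (Heavy? r)))
      -- Without budget no job can deviate: a positive `δ j` would force `w j ≤ Γ ≤ 0`, against
      -- positive weights. The factors 1 and 0 below express that each term is at most 0.
      ... | yes Γ≤0 = begin
        ∑∈ (T ∩ ∁ (heavy r)) δ      ≈⟨ *-identityˡ _ ⟨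
        1# * ∑∈ (T ∩ ∁ (heavy r)) δ ≤⟨ ∑∈-scaled-mono (p∩q⊆p T _) ≤-refl (λ j _ → w-nonNeg j) no-deviation ⟩
        0# * ∑∈ T w                 ≈⟨ zeroˡ _ ⟩
        0#                          ≤⟨ *-nonNeg (proj₁ 2#-pos) 0≤r ⟩
        2# * r                      ∎
        where
        no-deviation : ∀ j → j ∈ˢ (T ∩ ∁ (heavy r)) → 1# * δ j ≤ 0# * w j
        no-deviation j _ with δ j ≤? 0#
        ... | yes δ≤0 = ≤-trans (≤-reflexive (*-identityˡ _)) (≤-trans δ≤0 (≤-reflexive (sym (zeroˡ _))))
        ... | no  δ≰0 = contradiction (≤-trans (withinBudget j (≰⇒< δ≰0)) Γ≤0) (<⇒≱ (w-pos j))

      -- Relative to `sizes H`, only jobs of `T` outside `H` can grow, each by its `δ`. Their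
      -- deviations are counted on all machines, as `light-deviation` bounds them in total.
      load-split : ∀ U T H → ∑∈ U (sizes T) ≤ ∑∈ U (sizes H) + ∑∈ (T ∩ ∁ H) δ
      load-split U T H = ∑∈-subadditive pointwise
        where
        pointwise : ∀ j → (sizes T ↾ U) j ≤ (sizes H ↾ U) j + (δ ↾ (T ∩ ∁ H)) j
        pointwise j with j ∈? U | j ∈? T | j ∈? H | j ∈? (T ∩ ∁ H)
        ... | no  _ | _       | _       | yes _ = +-nonNeg ≤-refl (δ-nonNeg j)
        ... | no  _ | _       | _       | no  _ = +-nonNeg ≤-refl ≤-refl
        ... | yes _ | no  _   | no  _   | yes _ = x≤x+y (δ-nonNeg j)
        ... | yes _ | no  _   | no  _   | no  _ = x≤x+y ≤-refl
        ... | yes _ | no  _   | yes _   | yes _ = ≤-trans (p⁻≤p⁺ j) (x≤x+y (δ-nonNeg j))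
        ... | yes _ | no  _   | yes _   | no  _ = ≤-trans (p⁻≤p⁺ j) (x≤x+y ≤-refl)
        ... | yes _ | yes _   | yes _   | yes _ = x≤x+y (δ-nonNeg j)
        ... | yes _ | yes _   | yes _   | no  _ = x≤x+y ≤-refl
        ... | yes _ | yes _   | no  _   | yes _ = ≤-reflexive (sym (trans (+-comm _ _) (//-rightDividesˡ (p⁻ j) (p⁺ j))))
        ... | yes _ | yes j∈T | no  j∉H | no j∉ = contradiction (x∈p∩q⁺ (j∈T , x∉p⇒x∈∁p j∉H)) j∉

      -- Splicing a nominal and a robust schedule.

      module _ {lam : Carrier} (0<lam : 0# < lam) {q̂ : Scenario m n} (q̂∈𝓤 : q̂ ∈ Uncertainty I)
               (S R : Schedule m n) where

        private
          0≤lam = proj₁ 0<lam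
          p̂ = proj₁ q̂∈𝓤
          q̂-p̂ = proj₂ (proj₂ q̂∈𝓤)

          p̂-nonNeg : ∀ j → 0# ≤ p̂ j
          p̂-nonNeg j = ≤-trans (p⁻-nonNeg j) (proj₁ (feasible-bounds {p̂} (proj₁ (proj₂ q̂∈𝓤)) j))

        module _ {o r : Carrier} (0<o : 0# < o) (0<r : 0# < r) (S≤o : Cmax S q̂ ≤⁺ [ o ]) (R≤r : worst R ≤⁺ [ r ]) where

          private
            H = heavy r
            0≤o = proj₁ 0<o
            0≤r = proj₁ 0<r
            0≤lam*r = *-nonNeg 0≤lam 0≤r

            -- Divided by `o * r`, the test compares the share of `sizes H j` in `r` with `lam`
            -- times the share of `p̂ j` in `o`.
            Keep? : ∀ j → Dec (o * sizes H j ≤ (lam * r) * p̂ j)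
            Keep? j = o * sizes H j ≤? (lam * r) * p̂ j

            K = subset Keep?
            A = splice K S R

            S-load : ∀ i → ∑∈ (part S i) p̂ ≤ o
            S-load = Cmax≤⁻ {p̂} {q̂} q̂-p̂ S S≤o

            R-load : ∀ i → ∑∈ (part R i) (sizes H) ≤ r
            R-load i = heavy-load (part R i) 0<r (proj₂ (worst≤⁻ R R≤r) i)

          spliced-eligible : Eligible A
          spliced-eligible i j j∈A with x∈p∪q⁻ (part S i ∩ K) (part R i ∩ ∁ K) j∈A
          ... | inj₁ j∈S = Cmax≤⁻-eligible {p̂} {q̂} q̂-p̂ S S≤o i j (p∩q⊆p _ K j∈S)
          ... | inj₂ j∈R = proj₁ (worst≤⁻ R R≤r) i j (p∩q⊆p _ (∁ K) j∈R)

          -- Summed over kept jobs, the test turns the `p̂`-load of `S`, at most `o`, into a bound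
          -- for `sizes H`, and `o` cancels.
          kept-load : ∀ i → ∑∈ (part S i ∩ K) (sizes H) ≤ lam * r
          kept-load i = *-cancelˡ-≤ 0<o (begin
            o * ∑∈ (part S i ∩ K) (sizes H) ≤⟨ ∑∈-scaled-mono (p∩q⊆p _ K) 0≤lam*r (λ j _ → p̂-nonNeg j)
                                                (λ j → ∈-subset⁻ Keep? ∘ p∩q⊆q (part S i) K) ⟩
            lam * r * ∑∈ (part S i) p̂       ≤⟨ *-monoʳ-≤ 0≤lam*r (S-load i) ⟩
            lam * r * o                     ≈⟨ *-comm _ o ⟩
            o * (lam * r)                   ∎)

          -- Moved jobs fail the test, so the reverse comparison can be summed over a machine of
          -- `R`, whose load for `sizes H` is at most `r`.
          moved-load : ∀ i → ∑∈ (part R i ∩ ∁ K) p̂ ≤ lam ⁻¹ * o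
          moved-load i = *-cancelˡ-≤ (*-pos 0<lam 0<r) (begin
            lam * r * ∑∈ (part R i ∩ ∁ K) p̂ ≤⟨ ∑∈-scaled-mono (p∩q⊆p _ (∁ K)) 0≤o (λ j _ → sizes-nonNeg H j) moved ⟩
            o * ∑∈ (part R i) (sizes H)     ≤⟨ *-monoʳ-≤ 0≤o (R-load i) ⟩
            o * r                           ≈⟨ *-comm o r ⟩
            -- Writing 1 as `lam * lam ⁻¹` exposes the factor `lam * r` to be cancelled.
            r * o                           ≈⟨ *-identityˡ _ ⟨
            1# * (r * o)                    ≈⟨ *-congʳ (⁻¹-inverseʳ lam (proj₂ 0<lam ∘ sym)) ⟨
            lam * lam ⁻¹ * (r * o)          ≈⟨ interchange lam (lam ⁻¹) r o ⟩
            lam * r * (lam ⁻¹ * o)          ∎)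
            where
            moved : ∀ j → j ∈ˢ (part R i ∩ ∁ K) → lam * r * p̂ j ≤ o * sizes H j
            moved j j∈ = proj₁ (≰⇒< (x∈∁p⇒x∉p (p∩q⊆q (part R i) _ j∈) ∘ ∈-subset⁺ Keep?))

          spliced-consistent : Cmax A q̂ ≤⁺ [ (1# + lam ⁻¹) * o ]
          spliced-consistent = Cmax≤⁺ {p̂} {q̂} q̂-p̂ A (*-nonNeg (+-nonNeg 0≤1 (⁻¹-nonNeg 0<lam)) 0≤o)
            spliced-eligible (λ i → begin
              ∑∈ (part A i) p̂                                    ≤⟨ ∑∈-∪ p̂-nonNeg ⟩
              ∑∈ (part S i ∩ K) p̂ + ∑∈ (part R i ∩ ∁ K) p̂
                ≤⟨ +-mono-≤ (∑∈-mono (p∩q⊆p _ K) (λ j _ → p̂-nonNeg j) (λ j _ → ≤-refl)) (moved-load i) ⟩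
              ∑∈ (part S i) p̂ + lam ⁻¹ * o                       ≤⟨ +-mono-≤ (S-load i) ≤-refl ⟩
              o + lam ⁻¹ * o                                     ≈⟨ +-congʳ (*-identityˡ o) ⟨
              1# * o + lam ⁻¹ * o                                ≈⟨ distribʳ o 1# (lam ⁻¹) ⟨
              (1# + lam ⁻¹) * o                                  ∎)

          spliced-robust : worst A ≤⁺ [ (4# + 2# * lam) * r ]
          spliced-robust = worst≤⁺ A
            (*-nonNeg (+-nonNeg (+-nonNeg 0≤2 0≤2) (*-nonNeg 0≤2 0≤lam)) 0≤r) spliced-eligible (λ i T wT≤Γ → begin
              ∑∈ (part A i) (sizes T)                         ≤⟨ load-split (part A i) T H ⟩
              ∑∈ (part A i) (sizes H) + ∑∈ (T ∩ ∁ H) δ        ≤⟨ +-mono-≤ (A-load i) (light-deviation 0≤r T wT≤Γ) ⟩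
              -- Doubling the first two terms gives exactly the stated factor.
              lam * r + r + 2# * r                            ≤⟨ +-mono-≤ (+-mono-≤ (x≤2#*x 0≤lam*r) (x≤2#*x 0≤r)) ≤-refl ⟩
              2# * (lam * r) + 2# * r + 2# * r                ≈⟨ +-assoc _ _ _ ⟩
              2# * (lam * r) + (2# * r + 2# * r)              ≈⟨ +-comm _ _ ⟩
              2# * r + 2# * r + 2# * (lam * r)                ≈⟨ +-cong (distribʳ r 2# 2#) (*-assoc 2# lam r) ⟨
              4# * r + 2# * lam * r                           ≈⟨ distribʳ r 4# (2# * lam) ⟨
              (4# + 2# * lam) * r                             ∎)
            where
            0≤2 = proj₁ 2#-pos
            A-load : ∀ i → ∑∈ (part A i) (sizes H) ≤ lam * r + r
            A-load i = begin
              ∑∈ (part A i) (sizes H)                                     ≤⟨ ∑∈-∪ (sizes-nonNeg H) ⟩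
              ∑∈ (part S i ∩ K) (sizes H) + ∑∈ (part R i ∩ ∁ K) (sizes H)
                ≤⟨ +-mono-≤ (kept-load i) (≤-trans
                     (∑∈-mono (p∩q⊆p _ (∁ K)) (λ j _ → sizes-nonNeg H j) (λ j _ → ≤-refl)) (R-load i)) ⟩
              lam * r + r                                                 ∎

          spliced : ∃[ A ] (Cmax A q̂ ≤⁺ [ (1# + lam ⁻¹) * o ] × worst A ≤⁺ [ (4# + 2# * lam) * r ])
          spliced = A , spliced-consistent , spliced-robust

        -- Every job sits on some machine of `S`, whose load is at most 0, so its predicted size
        -- vanishes and any eligible schedule costs 0.
        zero-load : ∀ {o} → o ≤ 0# → Cmax S q̂ ≤⁺ [ o ] → Eligible R → Cmax R q̂ ≤⁺ [ 0# ]
        zero-load {o} o≤0 S≤o el = Cmax≤⁺ {p̂} {q̂} q̂-p̂ R ≤-refl el (λ i → begin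
          ∑∈ (part R i) p̂        ≈⟨ *-identityˡ _ ⟨
          1# * ∑∈ (part R i) p̂   ≤⟨ ∑∈-scaled-mono ⊆-refl ≤-refl (λ j _ → p̂-nonNeg j) (λ j _ → vanishes j) ⟩
          0# * ∑∈ (part R i) p̂   ≈⟨ zeroˡ _ ⟩
          0#                     ∎)
          where
          vanishes : ∀ j → 1# * p̂ j ≤ 0# * p̂ j
          vanishes j = let i , j∈S = covers S j in begin
            1# * p̂ j        ≈⟨ *-identityˡ _ ⟩
            p̂ j             ≈⟨ ∑∈-⁅⁆ j ⟨
            ∑∈ ⁅ j ⁆ p̂      ≤⟨ ∑∈-mono (λ k∈ → ≡.subst (_∈ˢ part S i) (≡.sym (x∈⁅y⁆⇒x≡y j k∈)) j∈S)
                                 (λ j _ → p̂-nonNeg j) (λ j _ → ≤-refl) ⟩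
            ∑∈ (part S i) p̂ ≤⟨ Cmax≤⁻ {p̂} {q̂} q̂-p̂ S S≤o i ⟩
            o               ≤⟨ o≤0 ⟩
            0#              ≈⟨ zeroˡ _ ⟨
            0# * p̂ j        ∎

        -- Splicing needs finite positive values. If `worst R` is infinite, `S` will do; if
        -- `Cmax S q̂` is 0, `R` will do. `S≤W` excludes an infinite `Cmax S q̂` next to a finite
        -- `worst R`.
        balanced : Cmax S q̂ ≤⁺ Cmax R q̂ →
                   ∃[ A ] (Cmax A q̂ ≤⁺ (1# + lam ⁻¹) · Cmax S q̂ × worst A ≤⁺ (4# + 2# * lam) · worst R)
        balanced S≤R = cases (Cmax S q̂) (worst R) ≡.refl ≡.refl
          where
          S≤W : Cmax S q̂ ≤⁺ worst R
          S≤W = ≤⁺-trans S≤R (uncertain≤worst R {q̂} q̂∈𝓤)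

          x≤a·x : ∀ {a x} → 1# ≤ a → [ 0# ] ≤⁺ x → x ≤⁺ a · x
          x≤a·x {a} {[ x ]} 1≤a [ 0≤x ] = [ (begin
            x      ≈⟨ *-identityʳ x ⟨
            x * 1# ≤⟨ *-monoʳ-≤ 0≤x 1≤a ⟩
            x * a  ≈⟨ *-comm x a ⟩
            a * x  ∎) ]
          x≤a·x {x = ⊤⁺} _ _ = _ ≤⊤⁺

          1≤1+lam⁻¹ : 1# ≤ 1# + lam ⁻¹
          1≤1+lam⁻¹ = x≤x+y (⁻¹-nonNeg 0<lam)

          1≤4+2lam : 1# ≤ 4# + 2# * lam
          1≤4+2lam = ≤-trans (x≤x+y 0≤1) (≤-trans (x≤x+y (proj₁ 2#-pos)) (x≤x+y (*-nonNeg (proj₁ 2#-pos) 0≤lam)))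

          -- The two values become variables tied by equations, so that they can be matched on while
          -- the schedules stay as they are.
          cases : ∀ x y → Cmax S q̂ ≡ x → worst R ≡ y →
                  ∃[ A ] (Cmax A q̂ ≤⁺ (1# + lam ⁻¹) · x × worst A ≤⁺ (4# + 2# * lam) · y)
          cases _ ⊤⁺ ≡.refl _ = S , x≤a·x 1≤1+lam⁻¹ (max⁺-nonNeg (load S q̂)) , (_ ≤⊤⁺)
          cases ⊤⁺ [ r ] S≡ R≡ with ≡.subst₂ _≤⁺_ S≡ R≡ S≤W
          ... | ()
          cases [ o ] [ r ] S≡ R≡ with o ≤? 0# | ≤⁺-reflexive (≈⁺-reflexive S≡) | ≤⁺-reflexive (≈⁺-reflexive R≡)
          ... | yes o≤0 | S≤o | R≤r = R , ≤⁺-trans (zero-load o≤0 S≤o (proj₁ (worst≤⁻ R R≤r)))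
                  [ *-nonNeg (≤-trans 0≤1 1≤1+lam⁻¹) 0≤o ] , ≡.subst (λ y → worst R ≤⁺ (4# + 2# * lam) · y) R≡
                    (x≤a·x 1≤4+2lam (max⁺-nonNeg (load R (scenario (worstSet R)))))
            where
            0≤o : 0# ≤ o
            0≤o = [≤]-injective (≡.subst ([ 0# ] ≤⁺_) S≡ (max⁺-nonNeg (load S q̂)))
          -- Here `r` is positive as well, since `S≤W` gives `o ≤ r`.
          ... | no  o≰0 | S≤o | R≤r = spliced (≰⇒< o≰0)
                  (<-≤-trans (≰⇒< o≰0) ([≤]-injective (≡.subst₂ _≤⁺_ S≡ R≡ S≤W))) S≤o R≤r

    -- The worst set of the new schedule is affordable, hence also counted in `worst S`; passing to
    -- an enumerated schedule keeps the robustness bound.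
    worst-assignment : ∀ S → worst (fromAssignment (assignment S)) ≤⁺ worst S
    worst-assignment S = ≤⁺-trans (Cmax-assignment S (scenario T)) (scenario≤worst S T (weight-worstSet S′))
      where
      S′ = fromAssignment (assignment S)
      T  = worstSet S′

  -- The algorithm as an exhaustive search.

  module Solution (lam : Carrier) {m n : ℕ} .{{_ : NonZero m}} (I : Instance m n) (q̂ : Scenario m n) where
    open Uncertain I using (worst; worst-assignment; balanced)
    open Minimisation (flipOrder 𝔹-totalOrder) using (Fin-minimisable; Vec-minimisable)

    opt optrob : ℝ∞
    opt    = Cmax (proj₁ (optimal (λ S → Cmax S q̂))) q̂
    optrob = worst (proj₁ (optimal worst))

    Balanced : Schedule m n → Set _
    Balanced A = Cmax A q̂ ≤⁺ (1# + lam ⁻¹) · opt × worst A ≤⁺ (4# + 2# * lam) · optrob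

    Balanced? : Decidable Balanced
    Balanced? A = ≤⁺-dec _≤?_ (Cmax A q̂) ((1# + lam ⁻¹) · opt)
            ×-dec ≤⁺-dec _≤?_ (worst A) ((4# + 2# * lam) · optrob)

    private
      search : ∃[ σ ] (∃ (Balanced ∘ fromAssignment) → Balanced (fromAssignment σ))
      search = find (Vec-minimisable (Fin-minimisable m) n) (Balanced? ∘ fromAssignment)

    -- An `Algorithm` receives no proofs, whereas splicing takes `p̂` from the membership of `q̂` in
    -- the uncertainty set. The schedule is therefore searched for by its two bounds, and `balanced`
    -- supplies existence.
    schedule : Schedule m n
    schedule = fromAssignment (proj₁ search)

    schedule-balanced : 0# < lam → WeightsWithinBudget I → q̂ ∈ Uncertainty I → Balanced schedule
    schedule-balanced 0<lam withinBudget q̂∈𝓤 =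
      let A , consistent , robust = balanced withinBudget 0<lam {q̂} q̂∈𝓤 S R S≤R
      -- The balanced schedule is re-encoded as an assignment vector, at no greater cost, to be a
      -- witness for the search.
      in proj₂ search (assignment A , ≤⁺-trans (Cmax-assignment A q̂) consistent , ≤⁺-trans (worst-assignment A) robust)
      where
      S = proj₁ (optimal (λ S → Cmax S q̂))
      R = proj₁ (optimal worst)
      S≤R : Cmax S q̂ ≤⁺ Cmax R q̂
      S≤R = proj₂ (optimal-isOPT q̂) (Cmax R q̂) (R , ≈⁺-refl)

theorem20 : ∀ {c ℓ₁ ℓ₂ : Level} (ℝ : RealNumbers c ℓ₁ ℓ₂) →
  let open RealNumbers ℝ
      open Scheduling ℝ
  in
  (lam : Carrier) → 0# < lam →
  Σ[ alg ∈ Algorithm ]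
    (∀ {m n : ℕ} .{{_ : NonZero m}} (I : Instance m n) →
      WeightsWithinBudget I →
      (q̂ : Scenario m n) → q̂ ∈ Uncertainty I →
        (∃[ opt ] (IsOPT q̂ opt
                 × Cmax (alg I q̂) q̂ ≤⁺ (1# + lam ⁻¹) · opt))
      × (∃[ cost ] ∃[ opt ] (IsWorstCase (Uncertainty I) (alg I q̂) cost
                           × IsOPTrob (Uncertainty I) opt
                           × cost ≤⁺ (4# + 2# * lam) · opt)))
theorem20 ℝ lam 0<lam = (λ I q̂ → schedule I q̂) , λ I wb q̂ q̂∈𝓤 →
  let consistent , robust = schedule-balanced I q̂ 0<lam wb q̂∈𝓤
  in (opt I q̂ , optimal-isOPT q̂ , consistent)
   , (_ , optrob I q̂ , Uncertain.worst-isWorstCase I (schedule I q̂) , Uncertain.optimal-isOPTrob I , robust)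
  where
  open Makespan ℝ
  open Solution lam
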